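{- Let $\mathbf{s}=(s_1,s_2,\ldots,s_d)$ be a monotone sequence of positive integers. Then the polytope $\mathbf{P}_d^{(\mathbf{s})}$ is IDP.
   Context: For a sequence of positive integers $\mathbf{s}=(s_1,\ldots,s_d)$, the $\mathbf{s}$-lecture hall polytope is $\mathbf{P}_d^{(\mathbf{s})}=\{\mathbf{x}\in\mathbb{R}^d : 0\le \frac{x_1}{s_1}\le\frac{x_2}{s_2}\le\cdots\le\frac{x_d}{s_d}\le 1\}$, a $d$-dimensional lattice polytope. Monotone means weakly increasing or weakly decreasing. A lattice polytope $\mathcal{P}\subset\mathbb{R}^d$ is IDP (satisfies the integer decomposition property) if for every positive integer $k$ and every $\mathbf{z}\in k\mathcal{P}\cap\mathbb{Z}^d$ there exist $\mathbf{x}_1,\ldots,\mathbf{x}_k\in\mathcal{P}\cap\mathbb{Z}^d$ with $\mathbf{x}_1+\cdots+\mathbf{x}_k=\mathbf{z}$, where $k\mathcal{P}=\{k\alpha:\alpha\in\mathcal{P}\}$. -}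

module Defs where

open import Algebra.Definitions.RawMonoid using (sum)
open import Data.Fin.Base as Fin using (Fin)
open import Data.Integer.Base as ℤ using (ℤ; +_)
open import Data.Nat.Base as ℕ using (ℕ)
open import Data.Product.Base using (Σ-syntax; ∃-syntax; _×_; _,_)
open import Data.Rational.Base as ℚ
  using (ℚ; 0ℚ; 1ℚ; _<_; _*_; Positive; 1/_) renaming (_/_ to _/ℚ_)
open import Data.Rational.Properties
open import Data.Sum.Base using (_⊎_; inj₁; inj₂)
open import Data.Vec.Base using (tabulate; _∷_; _∷ʳ_)
open import Data.Vec.Functional using (Vector)
open import Data.Vec.Relation.Unary.Linked using (Linked)
open import Function.Base using (_∘_)
open import Function.Bundles using (_⇔_; mk⇔; module Equivalence)
open import Level using (Level; 0ℓ; suc; _⊔_)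
open import Relation.Binary.Definitions using (Monotonic₁; Antitonic₁; tri<; tri≈; tri>)
open import Relation.Binary.PropositionalEquality
open import Relation.Nullary.Negation using (¬_)
open import Relation.Unary using (Pred)

private
  variable
    ℓ : Level
    d : ℕ

-- The real numbers, as two-sided Dedekind cuts of ℚ: L q means q < x and
-- U q means x < q.
record ℝ : Set₁ where
  field
    L U         : ℚ → Set
    L-inhabited : ∃[ q ] L q
    U-inhabited : ∃[ q ] U q
    L-rounded   : ∀ q → L q ⇔ (∃[ r ] q < r × L r)
    U-rounded   : ∀ r → U r ⇔ (∃[ q ] q < r × U q)
    disjoint    : ∀ q → ¬ (L q × U q)
    located     : ∀ {q r} → q < r → L q ⊎ U r

open ℝ

infix 4 _≤_ _≃_

_≤_ : ℝ → ℝ → Set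
x ≤ y = ∀ q → L x q → L y q

-- ℝ is used as a setoid: distinct predicates can present the same cut.
_≃_ : ℝ → ℝ → Set
x ≃ y = x ≤ y × y ≤ x

fromℚ : ℚ → ℝ
fromℚ p = record
  { L           = _< p
  ; U           = p <_
  ; L-inhabited = p ℚ.- 1ℚ , p-1<p
  ; U-inhabited = p ℚ.+ 1ℚ , p<p+1
  ; L-rounded   = λ q → mk⇔ (λ q<p → let r , q<r , r<p = <-dense q<p in r , q<r , r<p)
                            (λ (r , q<r , r<p) → <-trans q<r r<p)
  ; U-rounded   = λ r → mk⇔ (λ p<r → let q , p<q , q<r = <-dense p<r in q , q<r , p<q)
                            (λ (q , q<r , p<q) → <-trans p<q q<r)
  ; disjoint    = λ q (q<p , p<q) → <-asym q<p p<q
  ; located     = loc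
  }
  where
  p-1<p : p ℚ.- 1ℚ < p
  p-1<p = subst (p ℚ.- 1ℚ <_) (+-identityʳ p)
            (+-monoʳ-< p (negative⁻¹ (ℚ.- 1ℚ)))
  p<p+1 : p < p ℚ.+ 1ℚ
  p<p+1 = subst (_< p ℚ.+ 1ℚ) (+-identityʳ p)
            (+-monoʳ-< p (positive⁻¹ 1ℚ))
  loc : ∀ {q r} → q < r → q < p ⊎ p < r
  loc {q} q<r with <-cmp q p
  ... | tri< q<p _ _ = inj₁ q<p
  ... | tri≈ _ refl _ = inj₂ q<r
  ... | tri> _ _ p<q = inj₂ (<-trans p<q q<r)

fromℤ : ℤ → ℝ
fromℤ z = fromℚ (z /ℚ 1)

0ℝ 1ℝ : ℝ
0ℝ = fromℚ 0ℚ
1ℝ = fromℚ 1ℚ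

-- Division by a positive rational: q < x / c iff q * c < x, and dually.
divℚ : ℝ → (c : ℚ) → .{{Positive c}} → ℝ
divℚ x c {{c>0}} = record
  { L           = λ q → L x (q * c)
  ; U           = λ q → U x (q * c)
  ; L-inhabited = let q , Lq = L-inhabited x in q * c⁻¹ , subst (L x) (sym (cancel q)) Lq
  ; U-inhabited = let q , Uq = U-inhabited x in q * c⁻¹ , subst (U x) (sym (cancel q)) Uq
  ; L-rounded   = λ q → mk⇔
      (λ Lqc → let r , qc<r , Lr = Equivalence.to (L-rounded x (q * c)) Lqc in
        r * c⁻¹ ,
        *-cancelʳ-<-nonNeg c {{c≥0}} (subst (q * c <_) (sym (cancel r)) qc<r) ,
        subst (L x) (sym (cancel r)) Lr)
      (λ (r , q<r , Lrc) →
        Equivalence.from (L-rounded x (q * c)) (r * c , *-monoˡ-<-pos c q<r , Lrc))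
  ; U-rounded   = λ r → mk⇔
      (λ Urc → let q , q<rc , Uq = Equivalence.to (U-rounded x (r * c)) Urc in
        q * c⁻¹ ,
        *-cancelʳ-<-nonNeg c {{c≥0}} (subst (_< r * c) (sym (cancel q)) q<rc) ,
        subst (U x) (sym (cancel q)) Uq)
      (λ (q , q<r , Uqc) →
        Equivalence.from (U-rounded x (r * c)) (q * c , *-monoˡ-<-pos c q<r , Uqc))
  ; disjoint    = λ q → disjoint x (q * c)
  ; located     = λ q<r → located x (*-monoˡ-<-pos c q<r)
  }
  where
  instance
    c≢0 : ℚ.NonZero c
    c≢0 = pos⇒nonZero c
  c≥0 : ℚ.NonNegative c
  c≥0 = pos⇒nonNeg c
  c⁻¹ : ℚ
  c⁻¹ = 1/ c
  cancel : ∀ q → q * c⁻¹ * c ≡ q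
  cancel q = trans (*-assoc q c⁻¹ c)
               (trans (cong (q *_) (*-inverseˡ c)) (*-identityʳ q))

infixl 7 _/_ _·_

_/_ : ℝ → (n : ℕ) → .{{ℕ.NonZero n}} → ℝ
x / n = divℚ x (+ n /ℚ 1) {{normalize-pos n 1}}

-- Multiplication by k is division by 1/k.
_·_ : (k : ℕ) → .{{ℕ.NonZero k}} → ℝ → ℝ
k · x = divℚ x (+ 1 /ℚ k) {{normalize-pos 1 k}}

dilate : (k : ℕ) → .{{ℕ.NonZero k}} → Pred (Vector ℝ d) ℓ → Pred (Vector ℝ d) (suc 0ℓ ⊔ ℓ)
dilate k P z = ∃[ α ] P α × (∀ i → k · α i ≃ z i)

IDP : Pred (Vector ℝ d) ℓ → Set (suc 0ℓ ⊔ ℓ)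
IDP {d} P =
  ∀ (k : ℕ) .{{_ : ℕ.NonZero k}} (z : Vector ℤ d) →
  dilate k P (fromℤ ∘ z) →
  Σ[ x ∈ Vector (Vector ℤ d) k ]
    (∀ j → P (fromℤ ∘ x j)) ×
    (∀ i → sum ℤ.+-0-rawMonoid (λ j → x j i) ≡ z i)

-- The chain 0 ≤ x₁/s₁ ≤ x₂/s₂ ≤ ⋯ ≤ x_d/s_d ≤ 1.
lectureHallPolytope : (s : Vector ℕ d) → (∀ i → ℕ.NonZero (s i)) →
                      Pred (Vector ℝ d) (suc 0ℓ)
lectureHallPolytope s s≢0 x =
  Linked _≤_ (0ℝ ∷ (tabulate (λ i → (x i / s i) {{s≢0 i}}) ∷ʳ 1ℝ))

Monotone : Vector ℕ d → Set
Monotone s = Monotonic₁ Fin._≤_ ℕ._≤_ s ⊎ Antitonic₁ Fin._≤_ ℕ._≤_ s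

-- Cut t ∈ [0 , k] into its parts tⱼ = max(0 , min(t - j , 1)) for j < k.  Each tⱼ is weakly
-- increasing in t, so it carries the chain 0 ≤ z₁/s₁ ≤ ⋯ ≤ z_d/s_d ≤ k to a chain
-- between 0 and 1, and for t = z/s its numerator min(max(z - j s , 0) , s) over s is an integer.
-- The z of k P are integral, so every quantity involved is a rational cut, and the order
-- of the chains becomes an inequality of cross products in ℕ.

module Submission where

open import Defs
open import Algebra.Definitions.RawMonoid using (sum)
open import Algebra.Properties.Monoid.Sum using (sum-cong-≋)
open import Data.Fin.Base using (Fin; zero; suc; toℕ)
open import Data.Fin.Properties using (toℕ<n)
open import Data.Integer.Base as ℤ using (ℤ; +_)
import Data.Integer.Properties as ℤ
open import Data.Nat.Base as ℕ using (ℕ; NonZero; zero; suc; _∸_; _⊓_)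
import Data.Nat.Properties as ℕ
import Data.Nat.Tactic.RingSolver as ℕ-Ring
open import Data.Product.Base using (_×_; _,_; proj₁; proj₂)
open import Data.Rational.Base as ℚ using (ℚ; toℚᵘ)
import Data.Rational.Properties as ℚ
open import Data.Rational.Unnormalised.Base as ℚᵘ using (*≡*; *≤*)
import Data.Rational.Unnormalised.Properties as ℚᵘ
open import Data.Sum.Base using (inj₁; inj₂)
open import Data.Vec.Base using (Vec; []; _∷_; _∷ʳ_; tabulate)
open import Data.Vec.Functional using (Vector)
open import Data.Vec.Relation.Binary.Pointwise.Inductive using (Pointwise; []; _∷_; tabulate⁺)
open import Data.Vec.Relation.Unary.Linked using (Linked; [-]; []; _∷_)
open import Function.Base using (_∘_)
open import Relation.Binary.Core using (Rel; REL)
open import Relation.Binary.Definitions using (Transitive)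
open import Relation.Binary.PropositionalEquality

open ℝ

-- Chains and pointwise related vectors

module _ {a b t} {A : Set a} {B : Set b} {T : REL A B t} where

  Pointwise-∷ʳ⁺ : ∀ {n} {xs : Vec A n} {ys : Vec B n} {x y} →
                  Pointwise T xs ys → T x y → Pointwise T (xs ∷ʳ x) (ys ∷ʳ y)
  Pointwise-∷ʳ⁺ []       Txy = Txy ∷ []
  Pointwise-∷ʳ⁺ (p ∷ ps) Txy = p ∷ Pointwise-∷ʳ⁺ ps Txy

  -- Each link of `xs` is carried over by the `T`-witnesses at its two ends, so a chain can be
  -- mapped without indexing consecutive coordinates.
  Linked-resp-Pointwise : ∀ {r s} {R : Rel A r} {S : Rel B s} →
                          (∀ {x x′ y y′} → T x y → T x′ y′ → R x x′ → S y y′) →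
                          ∀ {n} {xs : Vec A n} {ys : Vec B n} →
                          Pointwise T xs ys → Linked R xs → Linked S ys
  Linked-resp-Pointwise R⇒S []           []         = []
  Linked-resp-Pointwise R⇒S (p ∷ [])     [-]        = [-]
  Linked-resp-Pointwise R⇒S (p ∷ q ∷ ps) (Rxy ∷ Rs) =
    R⇒S p q Rxy ∷ Linked-resp-Pointwise R⇒S (q ∷ ps) Rs

module _ {a r} {A : Set a} {R : Rel A r} (R-trans : Transitive R) where

  Linked-ends : ∀ {n} {x y} (xs : Vec A n) → Linked R (x ∷ (xs ∷ʳ y)) → R x y
  Linked-ends []       (Rxy ∷ [-]) = Rxy
  Linked-ends (_ ∷ xs) (Rxz ∷ Rs)  = R-trans Rxz (Linked-ends xs Rs)

  Linked-tabulate-between : ∀ {n} {x y} (f : Fin n → A) → Linked R (x ∷ (tabulate f ∷ʳ y)) →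
                            ∀ i → R x (f i) × R (f i) y
  Linked-tabulate-between f (Rxf ∷ Rs) zero    = Rxf , Linked-ends (tabulate (f ∘ suc)) Rs
  Linked-tabulate-between f (Rxf ∷ Rs) (suc i) =
    let Rff , Rfy = Linked-tabulate-between (f ∘ suc) Rs i in R-trans Rxf Rff , Rfy

-- Fractions as cross products

toℚᵘ-/ : ∀ m d .{{_ : NonZero d}} → toℚᵘ (m ℚ./ d) ℚᵘ.≃ m ℚᵘ./ d
toℚᵘ-/ m (suc d-1) = ℚ.toℚᵘ-fromℚᵘ (ℚᵘ.mkℚᵘ m d-1)

module _ (m n : ℤ) (d e : ℕ) .{{_ : NonZero d}} .{{_ : NonZero e}} where

  /-mono-≤ : m ℤ.* + e ℤ.≤ n ℤ.* + d → m ℚ./ d ℚ.≤ n ℚ./ e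
  /-mono-≤ me≤nd = ℚ.toℚᵘ-cancel-≤
    (ℚᵘ.≤-respˡ-≃ (ℚᵘ.≃-sym (toℚᵘ-/ m d))
      (ℚᵘ.≤-respʳ-≃ (ℚᵘ.≃-sym (toℚᵘ-/ n e)) (go d e me≤nd)))
    where
    -- `m ℚᵘ./ d` reduces only when `d` is a successor, so both denominators are made arguments and
    -- matched.
    go : ∀ d e .{{_ : NonZero d}} .{{_ : NonZero e}} →
         m ℤ.* + e ℤ.≤ n ℤ.* + d → m ℚᵘ./ d ℚᵘ.≤ n ℚᵘ./ e
    go (suc _) (suc _) = *≤*

  /-cancel-≤ : m ℚ./ d ℚ.≤ n ℚ./ e → m ℤ.* + e ℤ.≤ n ℤ.* + d
  /-cancel-≤ m/d≤n/e = go d e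
    (ℚᵘ.≤-respˡ-≃ (toℚᵘ-/ m d) (ℚᵘ.≤-respʳ-≃ (toℚᵘ-/ n e) (ℚ.toℚᵘ-mono-≤ m/d≤n/e)))
    where
    go : ∀ d e .{{_ : NonZero d}} .{{_ : NonZero e}} →
         m ℚᵘ./ d ℚᵘ.≤ n ℚᵘ./ e → m ℤ.* + e ℤ.≤ n ℤ.* + d
    go (suc _) (suc _) (*≤* p) = p

  /-cross : m ℤ.* + e ≡ n ℤ.* + d → m ℚ./ d ≡ n ℚ./ e
  /-cross me≡nd = ℚ.toℚᵘ-injective
    (ℚᵘ.≃-trans (toℚᵘ-/ m d) (ℚᵘ.≃-trans (go d e me≡nd) (ℚᵘ.≃-sym (toℚᵘ-/ n e))))
    where
    go : ∀ d e .{{_ : NonZero d}} .{{_ : NonZero e}} →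
         m ℤ.* + e ≡ n ℤ.* + d → m ℚᵘ./ d ℚᵘ.≃ n ℚᵘ./ e
    go (suc _) (suc _) = *≡*

  /-*-/ : .{{_ : NonZero (d ℕ.* e)}} → (m ℚ./ d) ℚ.* (n ℚ./ e) ≡ (m ℤ.* n) ℚ./ (d ℕ.* e)
  /-*-/ = ℚ.toℚᵘ-injective
    (ℚᵘ.≃-trans (ℚ.toℚᵘ-homo-* (m ℚ./ d) (n ℚ./ e))
      (ℚᵘ.≃-trans (ℚᵘ.*-cong (toℚᵘ-/ m d) (toℚᵘ-/ n e))
        (ℚᵘ.≃-trans (go d e) (ℚᵘ.≃-sym (toℚᵘ-/ (m ℤ.* n) (d ℕ.* e))))))
    where
    go : ∀ d e .{{_ : NonZero d}} .{{_ : NonZero e}} .{{_ : NonZero (d ℕ.* e)}} →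
         (m ℚᵘ./ d) ℚᵘ.* (n ℚᵘ./ e) ℚᵘ.≃ (m ℤ.* n) ℚᵘ./ (d ℕ.* e)
    go (suc _) (suc _) = ℚᵘ.≃-refl

-- Rational cuts and their scaling

≤-trans : Transitive _≤_
≤-trans x≤y y≤z q = y≤z q ∘ x≤y q

≤-resp-≃ : ∀ {x x′ y y′} → x ≃ x′ → y ≃ y′ → x ≤ y → x′ ≤ y′
≤-resp-≃ x≃x′ y≃y′ x≤y q = proj₁ y≃y′ q ∘ x≤y q ∘ proj₂ x≃x′ q

fromℚ-cong : ∀ {p p′} → p ≡ p′ → fromℚ p ≃ fromℚ p′
fromℚ-cong refl = (λ _ q<p → q<p) , (λ _ q<p → q<p)

fromℚ-mono-≤ : ∀ {p p′} → p ℚ.≤ p′ → fromℚ p ≤ fromℚ p′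
fromℚ-mono-≤ p≤p′ q q<p = ℚ.<-≤-trans q<p p≤p′

-- If `p′ < p`, then `p′` would lie in the lower cut of `p`, hence below itself.
fromℚ-cancel-≤ : ∀ {p p′} → fromℚ p ≤ fromℚ p′ → p ℚ.≤ p′
fromℚ-cancel-≤ {p} {p′} h = ℚ.≮⇒≥ λ p′<p → ℚ.<-irrefl refl (h p′ p′<p)

module _ (x : ℝ) (p c : ℚ) {{c>0 : ℚ.Positive c}} where

  private
    instance
      c≥0 : ℚ.NonNegative c
      c≥0 = ℚ.pos⇒nonNeg c
      c≢0 : ℚ.NonZero c
      c≢0 = ℚ.pos⇒nonZero c

    /c*c : ∀ q → q ℚ.* ℚ.1/ c ℚ.* c ≡ q
    /c*c q = trans (ℚ.*-assoc q (ℚ.1/ c) c)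
               (trans (cong (q ℚ.*_) (ℚ.*-inverseˡ c)) (ℚ.*-identityʳ q))

  divℚ-fromℚ⁺ : x ≃ fromℚ (p ℚ.* c) → divℚ x c ≃ fromℚ p
  divℚ-fromℚ⁺ (x≤pc , pc≤x) =
    (λ q Lqc → ℚ.*-cancelʳ-<-nonNeg c (x≤pc (q ℚ.* c) Lqc)) ,
    (λ q q<p → pc≤x (q ℚ.* c) (ℚ.*-monoˡ-<-pos c q<p))

  -- The hypothesis tests `x` only at multiples of `c`, but every `q` is one, namely `q * 1/c * c`.
  divℚ-fromℚ⁻ : divℚ x c ≃ fromℚ p → x ≃ fromℚ (p ℚ.* c)
  divℚ-fromℚ⁻ (x/c≤p , p≤x/c) =
    (λ q Lq → subst (ℚ._< p ℚ.* c) (/c*c q)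
      (ℚ.*-monoˡ-<-pos c (x/c≤p (q ℚ.* ℚ.1/ c) (subst (L x) (sym (/c*c q)) Lq)))) ,
    (λ q q<pc → subst (L x) (/c*c q)
      (p≤x/c (q ℚ.* ℚ.1/ c)
        (ℚ.*-cancelʳ-<-nonNeg c (subst (ℚ._< p ℚ.* c) (sym (/c*c q)) q<pc))))

module _ (z : ℤ) (s : ℕ) .{{_ : NonZero s}} where

  fromℤ-/ : fromℤ z / s ≃ fromℚ (z ℚ./ s)
  fromℤ-/ = divℚ-fromℚ⁺ (fromℤ z) (z ℚ./ s) (+ s ℚ./ 1) {{ℚ.normalize-pos s 1}}
    (fromℚ-cong z≡z/s*s)
    where
    instance
      s*1≢0 : NonZero (s ℕ.* 1)
      s*1≢0 = ℕ.m*n≢0 s 1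
    z≡z/s*s : z ℚ./ 1 ≡ (z ℚ./ s) ℚ.* (+ s ℚ./ 1)
    z≡z/s*s = trans
      (/-cross z (z ℤ.* + s) 1 (s ℕ.* 1)
        (trans (cong (λ n → z ℤ.* + n) (ℕ.*-identityʳ s)) (sym (ℤ.*-identityʳ (z ℤ.* + s)))))
      (sym (/-*-/ z (+ s) s 1))

  -- This is where the real coordinates of a point of the polytope become rational: `k · α` is a
  -- division by `1/k`, so undoing it gives `α` as `z * (1/k)`, which equals `(z / ks) * s`.
  undilate : ∀ k .{{_ : NonZero k}} .{{_ : NonZero (k ℕ.* s)}} α → k · α ≃ fromℤ z →
             α / s ≃ fromℚ (z ℚ./ (k ℕ.* s))
  undilate k α kα≃z =
    divℚ-fromℚ⁺ α (z ℚ./ (k ℕ.* s)) (+ s ℚ./ 1) {{ℚ.normalize-pos s 1}}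
      (subst (λ p → α ≃ fromℚ p) eq
        (divℚ-fromℚ⁻ α (z ℚ./ 1) (+ 1 ℚ./ k) {{ℚ.normalize-pos 1 k}} kα≃z))
    where
    instance
      1*k≢0 : NonZero (1 ℕ.* k)
      1*k≢0 = ℕ.m*n≢0 1 k
      ks*1≢0 : NonZero (k ℕ.* s ℕ.* 1)
      ks*1≢0 = ℕ.m*n≢0 (k ℕ.* s) 1
    reassoc : ∀ k s → k ℕ.* s ℕ.* 1 ≡ s ℕ.* (1 ℕ.* k)
    reassoc = ℕ-Ring.solve-∀
    cross : z ℤ.* + 1 ℤ.* + (k ℕ.* s ℕ.* 1) ≡ z ℤ.* + s ℤ.* + (1 ℕ.* k)
    cross = begin
      z ℤ.* + 1 ℤ.* + (k ℕ.* s ℕ.* 1)  ≡⟨ cong₂ (λ m n → m ℤ.* + n) (ℤ.*-identityʳ z) (reassoc k s) ⟩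
      z ℤ.* + (s ℕ.* (1 ℕ.* k))        ≡⟨ cong (z ℤ.*_) (ℤ.pos-* s (1 ℕ.* k)) ⟩
      z ℤ.* (+ s ℤ.* + (1 ℕ.* k))      ≡⟨ ℤ.*-assoc z (+ s) (+ (1 ℕ.* k)) ⟨
      z ℤ.* + s ℤ.* + (1 ℕ.* k)        ∎
      where open ≡-Reasoning
    eq : (z ℚ./ 1) ℚ.* (+ 1 ℚ./ k) ≡ (z ℚ./ (k ℕ.* s)) ℚ.* (+ s ℚ./ 1)
    eq = trans (/-*-/ z (+ 1) 1 k)
      (trans (/-cross (z ℤ.* + 1) (z ℤ.* + s) (1 ℕ.* k) (k ℕ.* s ℕ.* 1) cross)
        (sym (/-*-/ z (+ s) (k ℕ.* s) 1)))

-- Slices of a numerator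

slice : ℕ → ℕ → ℕ → ℕ
slice s n j = (n ∸ j ℕ.* s) ⊓ s

-- Multiplication distributes over `∸` and `⊓`, so over the common denominator `s * t` both sides
-- are the same monotone function `u ↦ (u ∸ j(st)) ⊓ st`, taken at `m * t` and at `n * s`.
slice-mono : ∀ {m n s t} j → m ℕ.* t ℕ.≤ n ℕ.* s →
             slice s m j ℕ.* t ℕ.≤ slice t n j ℕ.* s
slice-mono {m} {n} {s} {t} j mt≤ns = begin
  ((m ∸ j ℕ.* s) ⊓ s) ℕ.* t                    ≡⟨ expand m s t ⟩
  (m ℕ.* t ∸ j ℕ.* (s ℕ.* t)) ⊓ (s ℕ.* t)      ≤⟨ ℕ.⊓-monoˡ-≤ (s ℕ.* t) (ℕ.∸-monoˡ-≤ (j ℕ.* (s ℕ.* t)) mt≤ns) ⟩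
  (n ℕ.* s ∸ j ℕ.* (s ℕ.* t)) ⊓ (s ℕ.* t)      ≡⟨ cong (λ u → (n ℕ.* s ∸ j ℕ.* u) ⊓ u) (ℕ.*-comm s t) ⟩
  (n ℕ.* s ∸ j ℕ.* (t ℕ.* s)) ⊓ (t ℕ.* s)      ≡⟨ expand n t s ⟨
  ((n ∸ j ℕ.* t) ⊓ t) ℕ.* s                    ∎
  where
  open ℕ.≤-Reasoning
  expand : ∀ m s t → ((m ∸ j ℕ.* s) ⊓ s) ℕ.* t ≡ (m ℕ.* t ∸ j ℕ.* (s ℕ.* t)) ⊓ (s ℕ.* t)
  expand m s t = trans (ℕ.*-distribʳ-⊓ t (m ∸ j ℕ.* s) s)
    (cong (_⊓ (s ℕ.* t))
      (trans (ℕ.*-distribʳ-∸ t m (j ℕ.* s)) (cong (m ℕ.* t ∸_) (ℕ.*-assoc j s t))))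

m⊓n+[m∸n]⊓o : ∀ m n o → m ⊓ n ℕ.+ (m ∸ n) ⊓ o ≡ m ⊓ (n ℕ.+ o)
m⊓n+[m∸n]⊓o m n o with ℕ.≤-total m n
... | inj₁ m≤n rewrite ℕ.m≤n⇒m∸n≡0 m≤n | ℕ.m≤n⇒m⊓n≡m m≤n
                     | ℕ.m≤n⇒m⊓n≡m (ℕ.m≤n⇒m≤n+o o m≤n) = ℕ.+-identityʳ m
... | inj₂ n≤m rewrite ℕ.m≥n⇒m⊓n≡n n≤m =
  trans (ℕ.+-distribˡ-⊓ n (m ∸ n) o) (cong (_⊓ (n ℕ.+ o)) (ℕ.m+[n∸m]≡n n≤m))

-- Induction peels off the lowest slice `n ⊓ s`. Stating the total as a minimum lets the hypothesis
-- apply to `n ∸ s` without a bound on `n`.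
sum-slice : ∀ k s n → sum ℤ.+-0-rawMonoid {k} (λ j → + slice s n (toℕ j)) ≡ + (n ⊓ (k ℕ.* s))
sum-slice zero    s n = cong +_ (sym (ℕ.⊓-zeroʳ n))
sum-slice (suc k) s n = begin
  + (n ⊓ s) ℤ.+ Σ (λ j → + slice s n (suc (toℕ j)))
    ≡⟨ cong (λ i → + (n ⊓ s) ℤ.+ i) (sum-cong-≋ ℤ.+-0-monoid {k}
         -- Slice `j + 1` of `n` is slice `j` of `n ∸ s`.
         (λ j → cong (λ m → + (m ⊓ s)) (sym (ℕ.∸-+-assoc n s (toℕ j ℕ.* s))))) ⟩
  + (n ⊓ s) ℤ.+ Σ (λ j → + slice s (n ∸ s) (toℕ j))
    ≡⟨ cong (λ i → + (n ⊓ s) ℤ.+ i) (sum-slice k s (n ∸ s)) ⟩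
  + (n ⊓ s ℕ.+ (n ∸ s) ⊓ (k ℕ.* s))
    ≡⟨ cong +_ (m⊓n+[m∸n]⊓o n s (k ℕ.* s)) ⟩
  + (n ⊓ (s ℕ.+ k ℕ.* s))
    ∎
  where
  open ≡-Reasoning
  Σ : Vector ℤ k → ℤ
  Σ = sum ℤ.+-0-rawMonoid

-- Slices of the points of a chain

module _ (k : ℕ) .{{_ : NonZero k}} where

  -- x is a point n/s of the chain for z, scaled from [0 , k] to [0 , 1]; y is its j-th part.
  record SliceOf (j : ℕ) (x y : ℝ) : Set where
    constructor mk
    field
      n s       : ℕ
      {{s≢0}}   : NonZero s
      {{ks≢0}}  : NonZero (k ℕ.* s)
      x≃n/ks    : x ≃ fromℚ (+ n ℚ./ (k ℕ.* s))
      y≃slice/s : y ≃ fromℚ (+ slice s n j ℚ./ s)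

  -- The order of `x` and `x′` becomes an inequality of cross products; the common factor `k`
  -- cancels, which leaves the hypothesis of `slice-mono`.
  SliceOf-mono : ∀ {j x x′ y y′} → SliceOf j x y → SliceOf j x′ y′ → x ≤ x′ → y ≤ y′
  SliceOf-mono {j} {x} {x′} {y} {y′} (mk n s x≃ y≃) (mk n′ s′ x′≃ y′≃) x≤x′ =
    ≤-resp-≃ {fromℚ _} {y} {fromℚ _} {y′} (proj₂ y≃ , proj₁ y≃) (proj₂ y′≃ , proj₁ y′≃)
      (fromℚ-mono-≤ (/-mono-≤ (+ slice s n j) (+ slice s′ n′ j) s s′
        (subst₂ ℤ._≤_ (ℤ.pos-* (slice s n j) s′) (ℤ.pos-* (slice s′ n′ j) s)
          (ℤ.+≤+ (slice-mono j ns′≤n′s)))))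
    where
    n*ks′≤n′*ks : n ℕ.* (k ℕ.* s′) ℕ.≤ n′ ℕ.* (k ℕ.* s)
    n*ks′≤n′*ks = ℤ.drop‿+≤+
      (subst₂ ℤ._≤_ (sym (ℤ.pos-* n (k ℕ.* s′))) (sym (ℤ.pos-* n′ (k ℕ.* s)))
        (/-cancel-≤ (+ n) (+ n′) (k ℕ.* s) (k ℕ.* s′)
          (fromℚ-cancel-≤ (≤-resp-≃ {x} {fromℚ _} {x′} {fromℚ _} x≃ x′≃ x≤x′))))
    swap : ∀ k a t → a ℕ.* (k ℕ.* t) ≡ k ℕ.* (a ℕ.* t)
    swap = ℕ-Ring.solve-∀
    ns′≤n′s : n ℕ.* s′ ℕ.≤ n′ ℕ.* s
    ns′≤n′s = ℕ.*-cancelˡ-≤ k (subst₂ ℕ._≤_ (swap k n s′) (swap k n′ s) n*ks′≤n′*ks)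

  private
    instance
      k*1≢0 : NonZero (k ℕ.* 1)
      k*1≢0 = ℕ.m*n≢0 k 1

  SliceOf-0 : ∀ j → SliceOf j 0ℝ 0ℝ
  SliceOf-0 j = mk 0 1
    (fromℚ-cong (/-cross (+ 0) (+ 0) 1 (k ℕ.* 1) refl))
    (fromℚ-cong (cong (λ n → + (n ⊓ 1) ℚ./ 1) (sym (ℕ.0∸n≡0 (j ℕ.* 1)))))

  -- The top end is `k / (k * 1)`, with slice `(k ∸ j) ⊓ 1`; the strict bound `j < k` makes this 1
  -- and not 0.
  SliceOf-1 : ∀ {j} → j ℕ.< k → SliceOf j 1ℝ 1ℝ
  SliceOf-1 {j} j<k = mk k 1
    (fromℚ-cong (/-cross (+ 1) (+ k) 1 (k ℕ.* 1)
      (trans (ℤ.*-identityˡ (+ (k ℕ.* 1))) (ℤ.pos-* k 1))))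
    (fromℚ-cong (cong (λ n → + n ℚ./ 1) (sym (ℕ.m≥n⇒m⊓n≡n 1≤k∸j))))
    where
    1≤k∸j : 1 ℕ.≤ k ∸ j ℕ.* 1
    1≤k∸j = subst (λ i → 1 ℕ.≤ k ∸ i) (sym (ℕ.*-identityʳ j)) (ℕ.m<n⇒0<n∸m j<k)

-- Decomposition of a lattice point of the dilate

theorem3p1 : (d : ℕ) (s : Vector ℕ d) (s≢0 : ∀ i → NonZero (s i)) →
    Monotone s → IDP (lectureHallPolytope s s≢0)
theorem3p1 d s s≢0 _ k z (α , chain , kα≃z) = x , x∈P , Σx≡z
  where
  instance
    sᵢ≢0 : ∀ {i} → NonZero (s i)
    sᵢ≢0 {i} = s≢0 i
    ksᵢ≢0 : ∀ {i} → NonZero (k ℕ.* s i)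
    ksᵢ≢0 {i} = ℕ.m*n≢0 k (s i)

  -- The lower end of the chain forces `z i` to be nonnegative (`0≤z`), so the absolute value
  -- changes nothing.
  n : Fin d → ℕ
  n i = ℤ.∣ z i ∣

  x : Vector (Vector ℤ d) k
  x j i = + slice (s i) (n i) (toℕ j)

  α/s : Fin d → ℝ
  α/s i = α i / s i

  α/s≃z/ks : ∀ i → α/s i ≃ fromℚ (z i ℚ./ (k ℕ.* s i))
  α/s≃z/ks i = undilate (z i) (s i) k (α i) (kα≃z i)

  bounds : ∀ i → 0ℝ ≤ α/s i × α/s i ≤ 1ℝ
  bounds = Linked-tabulate-between (λ {x} {y} {z} → ≤-trans {x} {y} {z}) α/s chain

  0≤z : ∀ i → + 0 ℤ.≤ z i
  0≤z i = subst (+ 0 ℤ.≤_) (ℤ.*-identityʳ (z i))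
    (/-cancel-≤ (+ 0) (z i) 1 (k ℕ.* s i)
      (fromℚ-cancel-≤ (≤-resp-≃ {0ℝ} {0ℝ} {α/s i} {fromℚ _}
        (fromℚ-cong {ℚ.0ℚ} refl) (α/s≃z/ks i) (proj₁ (bounds i)))))

  +n≡z : ∀ i → + n i ≡ z i
  +n≡z i = ℤ.0≤i⇒+∣i∣≡i (0≤z i)

  -- The upper end of the chain makes the minimum in `sum-slice` equal to `n i`.
  n≤ks : ∀ i → n i ℕ.≤ k ℕ.* s i
  n≤ks i = ℤ.drop‿+≤+
    (subst₂ ℤ._≤_ (trans (ℤ.*-identityʳ (z i)) (sym (+n≡z i))) (ℤ.*-identityˡ (+ (k ℕ.* s i)))
      (/-cancel-≤ (z i) (+ 1) (k ℕ.* s i) 1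
        (fromℚ-cancel-≤ (≤-resp-≃ {α/s i} {fromℚ _} {1ℝ} {1ℝ}
          (α/s≃z/ks i) (fromℚ-cong {ℚ.1ℚ} refl) (proj₂ (bounds i))))))

  x∈P : ∀ j → lectureHallPolytope s s≢0 (fromℤ ∘ x j)
  -- The chain of `α` is mapped link by link to that of `x j`; the ends 0 and 1 are their own `j`-th
  -- parts.
  x∈P j = Linked-resp-Pointwise {R = _≤_} {S = _≤_} (SliceOf-mono k) pointwise chain
    where
    slices : ∀ i → SliceOf k (toℕ j) (α/s i) (fromℤ (x j i) / s i)
    slices i = mk (n i) (s i)
      (subst (λ m → α/s i ≃ fromℚ (m ℚ./ (k ℕ.* s i))) (sym (+n≡z i)) (α/s≃z/ks i))
      (fromℤ-/ (x j i) (s i))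
    pointwise : Pointwise (SliceOf k (toℕ j)) (0ℝ ∷ (tabulate α/s ∷ʳ 1ℝ))
                  (0ℝ ∷ (tabulate (λ i → fromℤ (x j i) / s i) ∷ʳ 1ℝ))
    pointwise = SliceOf-0 k (toℕ j) ∷ Pointwise-∷ʳ⁺ (tabulate⁺ {f = α/s} slices) (SliceOf-1 k (toℕ<n j))

  Σx≡z : ∀ i → sum ℤ.+-0-rawMonoid (λ j → x j i) ≡ z i
  Σx≡z i = trans (sum-slice k (s i) (n i))
    (trans (cong +_ (ℕ.m≤n⇒m⊓n≡m (n≤ks i))) (+n≡z i))
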